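{- For all non-negative integers $n$ and $l$, $$\sum_{k=0}^{2n}(-1)^k\binom{2n}{k}S(k,l)\,S(2n-k,l)=S(n,l)\,S(n+l,n).$$
   Context: For non-negative integers $a$ and $b$, the super Catalan number is $S(a,b)=\dfrac{\binom{2a}{a}\binom{2b}{b}}{\binom{a+b}{a}}=\dfrac{(2a)!\,(2b)!}{a!\,b!\,(a+b)!}$; it is always an integer. -}

module Defs where

open import Data.Nat.Base using (ℕ; zero; suc; _+_; _*_; _∸_; _/_; _!; NonZero)
open import Data.Nat.Combinatorics using (_C_; nCk≡n!/k![n-k]!; k![n∸k]!∣n!)
open import Data.Nat.Divisibility using (_∣_; divides; *-cancelʳ-∣; *-monoˡ-∣; ∣m+n∣m⇒∣n)
open import Data.Nat.DivMod using (m/n*n≡m)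
open import Data.Nat.Properties using (_!≢0; _!*_!≢0; m*n≢0; m≤m+n; m+n∸m≡n; +-identityʳ; +-suc; *-suc; *-identityˡ; *-cancelʳ-≡)
open import Data.Nat.Solver using (module +-*-Solver)
open import Relation.Binary.PropositionalEquality using (_≡_; refl; sym; trans; cong; cong₂; subst; subst₂; module ≡-Reasoning)

superCatalanDenom : ℕ → ℕ → ℕ
superCatalanDenom a b = a ! * b ! * (a + b) !

superCatalanDenom≢0 : ∀ a b → NonZero (superCatalanDenom a b)
superCatalanDenom≢0 a b = m*n≢0 (a ! * b !) ((a + b) !)
  where instance
    _ = a !* b !≢0
    _ = (a + b) !≢0

-- _/_ is floor division; superCatalan-exact shows that nothing is rounded off.
superCatalan : ℕ → ℕ → ℕ
superCatalan a b = ((2 * a) ! * (2 * b) !) / superCatalanDenom a b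
  where instance _ = superCatalanDenom≢0 a b

open +-*-Solver

private
  [2+2a]! : ∀ a → (2 * suc a) ! ≡ (2 + 2 * a) * ((1 + 2 * a) * (2 * a) !)
  [2+2a]! a = cong _! (*-suc 2 a)

-- Induction on a, by the recurrence S (a + 1) b = 4 S a b − S a (b + 1).
superCatalanDenom-∣ : ∀ a b → superCatalanDenom a b ∣ (2 * a) ! * (2 * b) !
superCatalanDenom-∣ zero b = subst₂ _∣_
  (sym (cong (_* b !) (*-identityˡ (b !))))
  (sym (*-identityˡ ((2 * b) !)))
  (subst (λ x → b ! * x ! ∣ (2 * b) !)
         (trans (m+n∸m≡n b (b + 0)) (+-identityʳ b))
         (k![n∸k]!∣n! (m≤m+n b (b + 0))))
superCatalanDenom-∣ (suc a) b with superCatalanDenom-∣ a b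
... | divides q N≡q*D = subst₂ _∣_ denom numer
        (*-monoˡ-∣ (suc a * D) (∣m+n∣m⇒∣n (divides (4 * q) sum≡) m∣2[2b+1]q))
  where
  m D N : ℕ
  m = suc (a + b)
  D = superCatalanDenom a b
  N = (2 * a) ! * (2 * b) !

  instance
    D≢0 : NonZero D
    D≢0 = superCatalanDenom≢0 a b
    [1+b]D≢0 : NonZero (suc b * D)
    [1+b]D≢0 = m*n≢0 (suc b) D

  sum≡ : 2 * (1 + 2 * b) * q + 2 * (1 + 2 * a) * q ≡ 4 * q * m
  sum≡ = solve 3 (λ a b q →
    con 2 :* (con 1 :+ con 2 :* b) :* q :+ con 2 :* (con 1 :+ con 2 :* a) :* q
      := con 4 :* q :* (con 1 :+ (a :+ b))) refl a b q

  denom₁ : superCatalanDenom a (suc b) ≡ m * (suc b * D)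
  denom₁ = trans (cong (λ x → a ! * suc b ! * x !) (+-suc a b))
    (solve 5 (λ x y z m s → x :* (s :* y) :* (m :* z) := m :* (s :* (x :* y :* z)))
      refl (a !) (b !) ((a + b) !) m (suc b))

  numer₁ : (2 * a) ! * (2 * suc b) ! ≡ 2 * (1 + 2 * b) * q * (suc b * D)
  numer₁ = begin
    (2 * a) ! * (2 * suc b) !
      ≡⟨ cong ((2 * a) ! *_) ([2+2a]! b) ⟩
    (2 * a) ! * ((2 + 2 * b) * ((1 + 2 * b) * (2 * b) !))
      ≡⟨ solve 3 (λ x y b → x :* ((con 2 :+ con 2 :* b) :* ((con 1 :+ con 2 :* b) :* y))
           := con 2 :* (con 1 :+ con 2 :* b) :* (con 1 :+ b) :* (x :* y))
           refl ((2 * a) !) ((2 * b) !) b ⟩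
    2 * (1 + 2 * b) * suc b * N
      ≡⟨ cong (2 * (1 + 2 * b) * suc b *_) N≡q*D ⟩
    2 * (1 + 2 * b) * suc b * (q * D)
      ≡⟨ solve 4 (λ c s q D → c :* s :* (q :* D) := c :* q :* (s :* D))
           refl (2 * (1 + 2 * b)) (suc b) q D ⟩
    2 * (1 + 2 * b) * q * (suc b * D) ∎
    where open ≡-Reasoning

  m∣2[2b+1]q : m ∣ 2 * (1 + 2 * b) * q
  m∣2[2b+1]q = *-cancelʳ-∣ (suc b * D)
    (subst₂ _∣_ denom₁ numer₁ (superCatalanDenom-∣ a (suc b)))

  denom : m * (suc a * D) ≡ superCatalanDenom (suc a) b
  denom = solve 5 (λ x y z m s → m :* (s :* (x :* y :* z)) := s :* x :* y :* (m :* z))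
    refl (a !) (b !) ((a + b) !) m (suc a)

  numer : 2 * (1 + 2 * a) * q * (suc a * D) ≡ (2 * suc a) ! * (2 * b) !
  numer = begin
    2 * (1 + 2 * a) * q * (suc a * D)
      ≡⟨ solve 4 (λ c s q D → c :* q :* (s :* D) := c :* s :* (q :* D))
           refl (2 * (1 + 2 * a)) (suc a) q D ⟩
    2 * (1 + 2 * a) * suc a * (q * D)
      ≡⟨ cong (2 * (1 + 2 * a) * suc a *_) N≡q*D ⟨
    2 * (1 + 2 * a) * suc a * N
      ≡⟨ solve 3 (λ x y a → con 2 :* (con 1 :+ con 2 :* a) :* (con 1 :+ a) :* (x :* y)
           := (con 2 :+ con 2 :* a) :* ((con 1 :+ con 2 :* a) :* x) :* y)
           refl ((2 * a) !) ((2 * b) !) a ⟩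
    (2 + 2 * a) * ((1 + 2 * a) * (2 * a) !) * (2 * b) !
      ≡⟨ cong (_* (2 * b) !) ([2+2a]! a) ⟨
    (2 * suc a) ! * (2 * b) ! ∎
    where open ≡-Reasoning

superCatalan-exact : ∀ a b → superCatalan a b * (a ! * b ! * (a + b) !) ≡ (2 * a) ! * (2 * b) !
superCatalan-exact a b = m/n*n≡m (superCatalanDenom-∣ a b)
  where instance _ = superCatalanDenom≢0 a b

private
  C-! : ∀ a b → ((a + b) C a) * (a ! * b !) ≡ (a + b) !
  C-! a b = begin
    ((a + b) C a) * (a ! * b !)
      ≡⟨ cong (λ x → ((a + b) C a) * (a ! * x !)) (m+n∸m≡n a b) ⟨
    ((a + b) C a) * (a ! * (a + b ∸ a) !)
      ≡⟨ cong (_* (a ! * (a + b ∸ a) !)) (nCk≡n!/k![n-k]! (m≤m+n a b)) ⟩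
    (a + b) ! / (a ! * (a + b ∸ a) !) * (a ! * (a + b ∸ a) !)
      ≡⟨ m/n*n≡m (k![n∸k]!∣n! (m≤m+n a b)) ⟩
    (a + b) ! ∎
    where
    open ≡-Reasoning
    instance _ = a !* (a + b ∸ a) !≢0

  2aCa-! : ∀ a → ((2 * a) C a) * (a ! * a !) ≡ (2 * a) !
  2aCa-! a = subst (λ x → ((a + x) C a) * (a ! * a !) ≡ (a + x) !) (sym (+-identityʳ a)) (C-! a a)

superCatalan-binomial : ∀ a b → superCatalan a b * ((a + b) C a) ≡ ((2 * a) C a) * ((2 * b) C b)
superCatalan-binomial a b = *-cancelʳ-≡ _ _ (a ! * b ! * (a ! * b !)) (begin
  superCatalan a b * ((a + b) C a) * (a ! * b ! * (a ! * b !))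
    ≡⟨ solve 3 (λ s c p → s :* c :* (p :* p) := s :* (p :* (c :* p)))
         refl (superCatalan a b) ((a + b) C a) (a ! * b !) ⟩
  superCatalan a b * (a ! * b ! * (((a + b) C a) * (a ! * b !)))
    ≡⟨ cong (λ x → superCatalan a b * (a ! * b ! * x)) (C-! a b) ⟩
  superCatalan a b * (a ! * b ! * (a + b) !)
    ≡⟨ superCatalan-exact a b ⟩
  (2 * a) ! * (2 * b) !
    ≡⟨ cong₂ _*_ (2aCa-! a) (2aCa-! b) ⟨
  ((2 * a) C a) * (a ! * a !) * (((2 * b) C b) * (b ! * b !))
    ≡⟨ solve 4 (λ c d x y → c :* (x :* x) :* (d :* (y :* y)) := c :* d :* (x :* y :* (x :* y)))
         refl ((2 * a) C a) ((2 * b) C b) (a !) (b !) ⟩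
  ((2 * a) C a) * ((2 * b) C b) * (a ! * b ! * (a ! * b !)) ∎)
  where
  open ≡-Reasoning
  instance
    _ = a !* b !≢0
    _ = m*n≢0 (a ! * b !) (a ! * b !)

{-# OPTIONS --safe #-}

-- The numbers S(k,l) are the moments of xᵏ for the weight (4 − x)ˡ/(π√(x(4 − x))) on [0,4],
-- so the sum is the Selberg-type integral of (x − y)²ⁿ against the product of two copies of this
-- weight.  Following Aomoto, integration by parts together with the symmetry x ↔ y gives a
-- first-order recurrence in n, and the right-hand side satisfies the same recurrence.
module Submission where

open import Defs
open import Data.Fin.Base using (Fin; zero; suc; toℕ; fromℕ; inject₁)
open import Data.Fin.Properties using (toℕ-inject₁; toℕ-fromℕ; toℕ≤pred[n])
open import Data.Integer.Base using (ℤ; +_; -_; _*_; _^_; _+_; _-_; 0ℤ; 1ℤ; -1ℤ)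
open import Data.Integer.Properties using (+-*-semiring; pos-*; ^-*-assoc; ^-zeroˡ; *-cancelˡ-≡; *-zeroˡ; *-zeroʳ; *-identityˡ; *-assoc; *-comm; +-identityʳ; i*j≢0)
open import Data.Integer.Solver using (module +-*-Solver)
open import Data.Nat.Base as ℕ using (ℕ; zero; suc; _∸_; _!)
open import Data.Nat.Combinatorics using (_C_; nCk+nC[k+1]≡[n+1]C[k+1]; k>n⇒nCk≡0)
import Data.Nat.Properties as ℕ
import Data.Nat.Solver as ℕ
open import Algebra.Properties.Semiring.Sum +-*-semiring using (sum; sum⁺-syntax; sum-cong-≗; sum-init-last; ∑-distrib-+; *-distribˡ-sum)
open import Relation.Binary.PropositionalEquality using (_≡_; refl; sym; trans; cong; cong₂; module ≡-Reasoning)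

open +-*-Solver
open ≡-Reasoning

-- Symmetry and one-step recurrence of the super Catalan numbers

superCatalan-comm : ∀ a b → superCatalan a b ≡ superCatalan b a
superCatalan-comm a b = ℕ.*-cancelʳ-≡ _ _ (superCatalanDenom a b) (begin
  superCatalan a b ℕ.* superCatalanDenom a b    ≡⟨ superCatalan-exact a b ⟩
  (2 ℕ.* a) ! ℕ.* (2 ℕ.* b) !                   ≡⟨ ℕ.*-comm ((2 ℕ.* a) !) _ ⟩
  (2 ℕ.* b) ! ℕ.* (2 ℕ.* a) !                   ≡⟨ superCatalan-exact b a ⟨
  superCatalan b a ℕ.* superCatalanDenom b a    ≡⟨ cong (superCatalan b a ℕ.*_) denom-comm ⟩
  superCatalan b a ℕ.* superCatalanDenom a b    ∎)
  where
  instance _ = superCatalanDenom≢0 a b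
  denom-comm : superCatalanDenom b a ≡ superCatalanDenom a b
  denom-comm = cong₂ (λ x y → x ℕ.* y !) (ℕ.*-comm (b !) (a !)) (ℕ.+-comm b a)

-- In the factorial formula, raising `a` multiplies the numerator by `(2a + 2)(2a + 1)` and the
-- denominator by `(a + 1)(a + b + 1)`; cancelling `a + 1` leaves `4a + 2`. For fixed `b` this is
-- the moment recurrence of the weight, the only fact about it that integration by parts uses.
superCatalan-sucˡ-ℕ : ∀ a b → suc (a ℕ.+ b) ℕ.* superCatalan (suc a) b ≡ (2 ℕ.+ 4 ℕ.* a) ℕ.* superCatalan a b
superCatalan-sucˡ-ℕ a b = ℕ.*-cancelʳ-≡ _ _ (suc a ℕ.* D) (begin
  suc (a ℕ.+ b) ℕ.* S′ ℕ.* (suc a ℕ.* D)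
    ≡⟨ N.solve 6 (λ m s a x y z → m N.:* s N.:* (a N.:* (x N.:* y N.:* z))
         N.:= s N.:* (a N.:* x N.:* y N.:* (m N.:* z))) refl (suc (a ℕ.+ b)) S′ (suc a) (a !) (b !) ((a ℕ.+ b) !) ⟩
  S′ ℕ.* superCatalanDenom (suc a) b
    ≡⟨ superCatalan-exact (suc a) b ⟩
  (2 ℕ.* suc a) ! ℕ.* (2 ℕ.* b) !
    ≡⟨ cong (λ x → x ! ℕ.* (2 ℕ.* b) !) (ℕ.*-suc 2 a) ⟩
  (2 ℕ.+ 2 ℕ.* a) ℕ.* ((1 ℕ.+ 2 ℕ.* a) ℕ.* (2 ℕ.* a) !) ℕ.* (2 ℕ.* b) !
    ≡⟨ N.solve 3 (λ a x y →
         (N.con 2 N.:+ N.con 2 N.:* a) N.:* ((N.con 1 N.:+ N.con 2 N.:* a) N.:* x) N.:* y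
         N.:= (N.con 2 N.:+ N.con 4 N.:* a) N.:* (N.con 1 N.:+ a) N.:* (x N.:* y))
         refl a ((2 ℕ.* a) !) ((2 ℕ.* b) !) ⟩
  (2 ℕ.+ 4 ℕ.* a) ℕ.* suc a ℕ.* ((2 ℕ.* a) ! ℕ.* (2 ℕ.* b) !)
    ≡⟨ cong ((2 ℕ.+ 4 ℕ.* a) ℕ.* suc a ℕ.*_) (superCatalan-exact a b) ⟨
  (2 ℕ.+ 4 ℕ.* a) ℕ.* suc a ℕ.* (S ℕ.* D)
    ≡⟨ N.solve 4 (λ c a s d → c N.:* a N.:* (s N.:* d) N.:= c N.:* s N.:* (a N.:* d)) refl (2 ℕ.+ 4 ℕ.* a) (suc a) S D ⟩
  (2 ℕ.+ 4 ℕ.* a) ℕ.* S ℕ.* (suc a ℕ.* D) ∎)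
  where
  module N = ℕ.+-*-Solver
  S S′ D : ℕ
  S = superCatalan a b
  S′ = superCatalan (suc a) b
  D = superCatalanDenom a b
  instance
    _ = superCatalanDenom≢0 a b
    _ = ℕ.m*n≢0 (suc a) D

superCatalan-sucˡ : ∀ a b → + suc (a ℕ.+ b) * + superCatalan (suc a) b ≡ (+ 2 + + 4 * + a) * + superCatalan a b
superCatalan-sucˡ a b = begin
  + suc (a ℕ.+ b) * + superCatalan (suc a) b      ≡⟨ pos-* (suc (a ℕ.+ b)) _ ⟨
  + (suc (a ℕ.+ b) ℕ.* superCatalan (suc a) b)    ≡⟨ cong +_ (superCatalan-sucˡ-ℕ a b) ⟩
  + ((2 ℕ.+ 4 ℕ.* a) ℕ.* superCatalan a b)        ≡⟨ pos-* (2 ℕ.+ 4 ℕ.* a) (superCatalan a b) ⟩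
  (+ 2 + + (4 ℕ.* a)) * + superCatalan a b        ≡⟨ cong (λ x → (+ 2 + x) * + superCatalan a b) (pos-* 4 a) ⟩
  (+ 2 + + 4 * + a) * + superCatalan a b          ∎

-- Powers of x - y under a functional on polynomials in x and y

-- If g i j is the value of a linear functional at xⁱyʲ, then Δ g m i j is its value at
-- (x − y)ᵐxⁱyʲ.
Δ : (ℕ → ℕ → ℤ) → ℕ → ℕ → ℕ → ℤ
Δ g zero    i j = g i j
Δ g (suc m) i j = Δ g m (suc i) j - Δ g m i (suc j)

Δ-binomial : ∀ g m i j →
  Δ g m i j ≡ ∑[ k ≤ m ] (-1ℤ ^ toℕ k * + (m C toℕ k) * g ((m ∸ toℕ k) ℕ.+ i) (toℕ k ℕ.+ j))
Δ-binomial g zero    i j = solve 1 (λ x → x := con 1ℤ :* con 1ℤ :* x :+ con 0ℤ) refl (g i j)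
Δ-binomial g (suc m) i j = sym (begin
  t zero + sum (λ k → t (suc k))
    -- `t zero` and `b zero` coincide, both binomial coefficients being 1; Pascal's rule splits the
    -- other terms.
    ≡⟨ cong (λ x → b zero + x) (trans (sum-cong-≗ pascal) (∑-distrib-+ (λ k → -1ℤ * a k) (λ k → b (suc k)))) ⟩
  b zero + (sum (λ k → -1ℤ * a k) + sum (λ k → b (suc k)))
    ≡⟨ cong (λ x → b zero + (x + sum (λ k → b (suc k)))) (*-distribˡ-sum -1ℤ a) ⟨
  b zero + (-1ℤ * sum a + sum (λ k → b (suc k)))
    ≡⟨ solve 3 (λ x y z → x :+ (con -1ℤ :* y :+ z) := x :+ z :- y) refl (b zero) (sum a) (sum (λ k → b (suc k))) ⟩
  sum b - sum a
    ≡⟨ cong (_- sum a) (sum-init-last b) ⟩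
  sum (λ k → b (inject₁ k)) + b (fromℕ (suc m)) - sum a
    ≡⟨ cong (λ x → sum (λ k → b (inject₁ k)) + x - sum a) b-last ⟩
  sum (λ k → b (inject₁ k)) + 0ℤ - sum a
    ≡⟨ cong (_- sum a) (+-identityʳ (sum (λ k → b (inject₁ k)))) ⟩
  sum (λ k → b (inject₁ k)) - sum a
    ≡⟨ cong₂ _-_ (trans (sum-cong-≗ b-inject₁) (sym (Δ-binomial g m (suc i) j)))
                 (sym (Δ-binomial g m i (suc j))) ⟩
  Δ g m (suc i) j - Δ g m i (suc j) ∎)
  where
  -- `b` lists the terms of x(x - y)ᵐ, with one extra index so that it lines up with `t`; the extra
  -- term vanishes. The family `a` below lists those of y(x - y)ᵐ, where the index k stands for the
  -- power k + 1 of y.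
  t b : Fin (suc (suc m)) → ℤ
  t k = -1ℤ ^ toℕ k * + (suc m C toℕ k) * g ((suc m ∸ toℕ k) ℕ.+ i) (toℕ k ℕ.+ j)
  b k = -1ℤ ^ toℕ k * + (m C toℕ k) * g ((suc m ∸ toℕ k) ℕ.+ i) (toℕ k ℕ.+ j)

  a : Fin (suc m) → ℤ
  a k = -1ℤ ^ toℕ k * + (m C toℕ k) * g ((m ∸ toℕ k) ℕ.+ i) (toℕ k ℕ.+ suc j)

  pascal : ∀ k → t (suc k) ≡ -1ℤ * a k + b (suc k)
  pascal k
    rewrite ℕ.+-suc (toℕ k) j
          | sym (nCk+nC[k+1]≡[n+1]C[k+1] m (toℕ k))
    = solve 4 (λ s c d x → con -1ℤ :* s :* (c :+ d) :* x
                 := con -1ℤ :* (s :* c :* x) :+ con -1ℤ :* s :* d :* x) refl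
        (-1ℤ ^ toℕ k) (+ (m C toℕ k)) (+ (m C suc (toℕ k)))
        (g ((m ∸ toℕ k) ℕ.+ i) (suc (toℕ k ℕ.+ j)))

  b-inject₁ : ∀ k → b (inject₁ k) ≡ -1ℤ ^ toℕ k * + (m C toℕ k) * g ((m ∸ toℕ k) ℕ.+ suc i) (toℕ k ℕ.+ j)
  b-inject₁ k
    rewrite toℕ-inject₁ k
          | ℕ.+-∸-assoc 1 (toℕ≤pred[n] k)
          | ℕ.+-suc (m ∸ toℕ k) i
    = refl

  b-last : b (fromℕ (suc m)) ≡ 0ℤ
  b-last
    rewrite toℕ-fromℕ m
          | k>n⇒nCk≡0 (ℕ.n<1+n m)
          | *-zeroʳ (-1ℤ * -1ℤ ^ m)
    = *-zeroˡ (g ((m ∸ m) ℕ.+ i) (suc m ℕ.+ j))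

-- Exchanging x and y negates each of the `m` factors x - y.
Δ-swap : ∀ g → (∀ i j → g i j ≡ g j i) → ∀ m i j → Δ g m i j ≡ -1ℤ ^ m * Δ g m j i
Δ-swap g g-comm zero    i j = trans (g-comm i j) (sym (*-identityˡ (g j i)))
Δ-swap g g-comm (suc m) i j = begin
  Δ g m (suc i) j - Δ g m i (suc j)
    ≡⟨ cong₂ _-_ (Δ-swap g g-comm m (suc i) j) (Δ-swap g g-comm m i (suc j)) ⟩
  -1ℤ ^ m * Δ g m j (suc i) - -1ℤ ^ m * Δ g m (suc j) i
    ≡⟨ solve 3 (λ s x y → s :* x :- s :* y := con -1ℤ :* s :* (y :- x)) refl
         (-1ℤ ^ m) (Δ g m j (suc i)) (Δ g m (suc j) i) ⟩
  -1ℤ * -1ℤ ^ m * (Δ g m (suc j) i - Δ g m j (suc i)) ∎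

-- Moments of the product weight and integration by parts

module _ (l : ℕ) where

  private
    L : ℤ
    L = + l

    f : ℕ → ℤ
    f i = + superCatalan i l

  M : ℕ → ℕ → ℕ → ℤ
  M = Δ (λ i j → f i * f j)

  -- m (x − y)ᵐ = m (x − y)ᵐ⁻¹ (x − y), also for m = 0.
  M-pred : ∀ m i j → + m * M m i j ≡ + m * M (ℕ.pred m) (suc i) j - + m * M (ℕ.pred m) i (suc j)
  M-pred zero    i j = refl
  M-pred (suc m) i j = solve 3 (λ c x y → c :* (x :- y) := c :* x :- c :* y) refl
    (+ suc m) (M m (suc i) j) (M m i (suc j))

  -- The value of the functional at x(4 − x) ∂ₓ((x − y)ᵐxⁱyʲ), as given by the weight.
  M-by-parts : ∀ m i j →
    (1ℤ + + i + L) * M m (suc i) j + + m * M (ℕ.pred m) (suc (suc i)) j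
    ≡ (+ 2 + + 4 * + i) * M m i j + + 4 * (+ m * M (ℕ.pred m) (suc i) j)
  M-by-parts zero i j = begin
    (1ℤ + + i + L) * (f (suc i) * f j) + 0ℤ
      ≡⟨ solve 3 (λ c x y → c :* (x :* y) :+ con 0ℤ := c :* x :* y) refl (1ℤ + + i + L) (f (suc i)) (f j) ⟩
    (1ℤ + + i + L) * f (suc i) * f j
      ≡⟨ cong (_* f j) (superCatalan-sucˡ i l) ⟩
    (+ 2 + + 4 * + i) * f i * f j
      ≡⟨ solve 3 (λ c x y → c :* x :* y := c :* (x :* y) :+ con 0ℤ) refl (+ 2 + + 4 * + i) (f i) (f j) ⟩
    (+ 2 + + 4 * + i) * (f i * f j) + 0ℤ ∎
  M-by-parts (suc m) i j = begin
    (1ℤ + I + L) * (A - B) + (1ℤ + + m) * A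
      -- The aim is the identity for `m` at `(i + 1, j)` minus that at `(i, j + 1)`. The coefficient
      -- for `i + 1` is larger by one, which absorbs one of the `1 + m` copies of `A`; `M-pred`
      -- expands the other `m`.
      ≡⟨ solve 5 (λ i l m a b →
           (con 1ℤ :+ i :+ l) :* (a :- b) :+ (con 1ℤ :+ m) :* a
           := (con 1ℤ :+ (con 1ℤ :+ i) :+ l) :* a :- (con 1ℤ :+ i :+ l) :* b :+ m :* a) refl I L (+ m) A B ⟩
    (1ℤ + (1ℤ + I) + L) * A - (1ℤ + I + L) * B + + m * A
      ≡⟨ cong (λ x → (1ℤ + (1ℤ + I) + L) * A - (1ℤ + I + L) * B + x) (M-pred m (suc (suc i)) j) ⟩
    (1ℤ + (1ℤ + I) + L) * A - (1ℤ + I + L) * B + (D₁ - D₂)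
      ≡⟨ solve 4 (λ a b c d → a :- b :+ (c :- d) := a :+ c :- (b :+ d)) refl
           ((1ℤ + (1ℤ + I) + L) * A) ((1ℤ + I + L) * B) D₁ D₂ ⟩
    ((1ℤ + (1ℤ + I) + L) * A + D₁) - ((1ℤ + I + L) * B + D₂)
      ≡⟨ cong₂ _-_ (M-by-parts m (suc i) j) (M-by-parts m i (suc j)) ⟩
    ((+ 2 + + 4 * (1ℤ + I)) * P + + 4 * D₂′) - ((+ 2 + + 4 * I) * Q + + 4 * D₃)
      -- Here too the shift from `i` to `i + 1` leaves an extra `4 * P`, which later raises the
      -- factor `m` to `1 + m`.
      ≡⟨ solve 5 (λ i p q d e →
           ((con (+ 2) :+ con (+ 4) :* (con 1ℤ :+ i)) :* p :+ con (+ 4) :* d)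
             :- ((con (+ 2) :+ con (+ 4) :* i) :* q :+ con (+ 4) :* e)
           := (con (+ 2) :+ con (+ 4) :* i) :* (p :- q) :+ con (+ 4) :* (p :+ (d :- e))) refl I P Q D₂′ D₃ ⟩
    (+ 2 + + 4 * I) * (P - Q) + + 4 * (P + (D₂′ - D₃))
      ≡⟨ cong (λ x → (+ 2 + + 4 * I) * (P - Q) + + 4 * (P + x)) (M-pred m (suc i) j) ⟨
    (+ 2 + + 4 * I) * (P - Q) + + 4 * (P + + m * P)
      ≡⟨ solve 4 (λ c p q m → c :* (p :- q) :+ con (+ 4) :* (p :+ m :* p)
           := c :* (p :- q) :+ con (+ 4) :* ((con 1ℤ :+ m) :* p)) refl (+ 2 + + 4 * I) P Q (+ m) ⟩
    (+ 2 + + 4 * I) * (P - Q) + + 4 * ((1ℤ + + m) * P) ∎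
    where
    I A B P Q D₁ D₂ D₂′ D₃ : ℤ
    I = + i
    A = M m (suc (suc i)) j
    B = M m (suc i) (suc j)
    P = M m (suc i) j
    Q = M m i (suc j)
    D₁ = + m * M (ℕ.pred m) (suc (suc (suc i))) j
    D₂ = + m * M (ℕ.pred m) (suc (suc i)) (suc j)
    D₂′ = + m * M (ℕ.pred m) (suc (suc i)) j
    D₃ = + m * M (ℕ.pred m) (suc i) (suc j)

  -- Symmetry in x and y for even m

  M-swap : ∀ m → -1ℤ ^ m ≡ 1ℤ → ∀ i j → M m i j ≡ M m j i
  M-swap m even i j = begin
    M m i j              ≡⟨ Δ-swap _ (λ i j → *-comm (f i) (f j)) m i j ⟩
    -1ℤ ^ m * M m j i    ≡⟨ cong (_* M m j i) even ⟩
    1ℤ * M m j i         ≡⟨ *-identityˡ (M m j i) ⟩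
    M m j i              ∎

  -- For even positive `m` the exponent `m - 1` is odd, hence the sign. The factor `m` settles
  -- `m = 0`, where the truncated predecessor is 0 and not odd.
  M-pred-swap : ∀ m → -1ℤ ^ m ≡ 1ℤ → ∀ i j → + m * M (ℕ.pred m) i j ≡ - (+ m * M (ℕ.pred m) j i)
  M-pred-swap zero    even i j = refl
  M-pred-swap (suc m) even i j = begin
    + suc m * M m i j
      ≡⟨ cong (+ suc m *_) (Δ-swap _ (λ i j → *-comm (f i) (f j)) m i j) ⟩
    + suc m * (-1ℤ ^ m * M m j i)
      ≡⟨ solve 3 (λ c s x → c :* (s :* x) := :- (c :* (con -1ℤ :* s :* x))) refl (+ suc m) (-1ℤ ^ m) (M m j i) ⟩
    - (+ suc m * (-1ℤ ^ suc m * M m j i))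
      ≡⟨ cong (λ x → - (+ suc m * (x * M m j i))) even ⟩
    - (+ suc m * (1ℤ * M m j i))
      ≡⟨ cong (λ x → - (+ suc m * x)) (*-identityˡ (M m j i)) ⟩
    - (+ suc m * M m j i) ∎

  M-diagonal : ∀ m → -1ℤ ^ m ≡ 1ℤ → ∀ i →
    + m * M m i i ≡ + 2 * (+ m * M (ℕ.pred m) (suc i) i)
  M-diagonal m even i = begin
    + m * M m i i  ≡⟨ M-pred m i i ⟩
    D - D′         ≡⟨ cong (λ x → D - x) (M-pred-swap m even i (suc i)) ⟩
    D - - D        ≡⟨ solve 1 (λ x → x :- :- x := con (+ 2) :* x) refl D ⟩
    + 2 * D        ∎
    where
    D D′ : ℤ
    D  = + m * M (ℕ.pred m) (suc i) i
    D′ = + m * M (ℕ.pred m) i (suc i)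

  -- Linear relations between moments of low degree

  -- Expanding `m * V` both as `D 2 0 - D 1 1` and, after a swap, as `D 1 1 - D 0 2` and adding
  -- gives `D 2 0 = m * V`. With `2 * D 1 0 = m * U`, integration by parts at `(0, 0)` then involves
  -- only `U` and `V`.
  M-10 : ∀ m → -1ℤ ^ m ≡ 1ℤ → (1ℤ + L + + m) * M m 1 0 ≡ (+ 2 + + 2 * + m) * M m 0 0
  M-10 m even = *-cancelˡ-≡ (+ 2) _ _ (begin
    + 2 * ((1ℤ + L + + m) * V)
      ≡⟨ solve 3 (λ l m v → con (+ 2) :* ((con 1ℤ :+ l :+ m) :* v)
           := con (+ 2) :* ((con 1ℤ :+ l) :* v) :+ (m :* v :+ m :* v)) refl L (+ m) V ⟩
    + 2 * ((1ℤ + L) * V) + (+ m * V + + m * V)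
      ≡⟨ cong (λ x → + 2 * ((1ℤ + L) * V) + x) (cong₂ _+_ (M-pred m 1 0)
           (trans (cong (+ m *_) (M-swap m even 1 0)) (M-pred m 0 1))) ⟩
    + 2 * ((1ℤ + L) * V) + ((D 2 0 - D 1 1) + (D 1 1 - D 0 2))
      ≡⟨ cong (λ x → + 2 * ((1ℤ + L) * V) + ((D 2 0 - D 1 1) + (D 1 1 - x))) (M-pred-swap m even 0 2) ⟩
    + 2 * ((1ℤ + L) * V) + ((D 2 0 - D 1 1) + (D 1 1 - - D 2 0))
      ≡⟨ solve 3 (λ a d e → con (+ 2) :* a :+ ((d :- e) :+ (e :- :- d)) := con (+ 2) :* (a :+ d)) refl
           ((1ℤ + L) * V) (D 2 0) (D 1 1) ⟩
    + 2 * ((1ℤ + L) * V + D 2 0)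
      ≡⟨ cong (+ 2 *_) (M-by-parts m 0 0) ⟩
    + 2 * (+ 2 * U + + 4 * D 1 0)
      ≡⟨ solve 2 (λ u d → con (+ 2) :* (con (+ 2) :* u :+ con (+ 4) :* d)
           := con (+ 4) :* (u :+ con (+ 2) :* d)) refl U (D 1 0) ⟩
    + 4 * (U + + 2 * D 1 0)
      ≡⟨ cong (λ x → + 4 * (U + x)) (M-diagonal m even 0) ⟨
    + 4 * (U + + m * U)
      ≡⟨ solve 2 (λ u m → con (+ 4) :* (u :+ m :* u)
           := con (+ 2) :* ((con (+ 2) :+ con (+ 2) :* m) :* u)) refl U (+ m) ⟩
    + 2 * ((+ 2 + + 2 * + m) * U) ∎)
    where
    U V : ℤ
    U = M m 0 0
    V = M m 1 0
    D : ℕ → ℕ → ℤ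
    D i j = + m * M (ℕ.pred m) i j

  -- Integration by parts at `(0, 1)`: antisymmetry kills `D 1 1`, and `2 * D 2 1` is `m * W`.
  M-11 : ∀ m → -1ℤ ^ m ≡ 1ℤ → (+ 2 + (L + L) + + m) * M m 1 1 ≡ + 4 * M m 1 0
  M-11 m even = begin
    (+ 2 + (L + L) + + m) * W
      ≡⟨ solve 3 (λ l m w → (con (+ 2) :+ (l :+ l) :+ m) :* w
           := con (+ 2) :* ((con 1ℤ :+ l) :* w) :+ m :* w) refl L (+ m) W ⟩
    + 2 * ((1ℤ + L) * W) + + m * W
      ≡⟨ cong (λ x → + 2 * ((1ℤ + L) * W) + x) (M-diagonal m even 1) ⟩
    + 2 * ((1ℤ + L) * W) + + 2 * D 2 1
      ≡⟨ solve 2 (λ a d → con (+ 2) :* a :+ con (+ 2) :* d := con (+ 2) :* (a :+ d)) refl ((1ℤ + L) * W) (D 2 1) ⟩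
    + 2 * ((1ℤ + L) * W + D 2 1)
      ≡⟨ cong (+ 2 *_) (M-by-parts m 0 1) ⟩
    + 2 * (+ 2 * M m 0 1 + + 4 * D 1 1)
      ≡⟨ solve 2 (λ v d → con (+ 2) :* (con (+ 2) :* v :+ con (+ 4) :* d)
           := con (+ 4) :* v :+ con (+ 4) :* (d :+ d)) refl (M m 0 1) (D 1 1) ⟩
    + 4 * M m 0 1 + + 4 * (D 1 1 + D 1 1)
      ≡⟨ cong₂ (λ x y → + 4 * x + + 4 * (D 1 1 + y)) (M-swap m even 0 1) (M-pred-swap m even 1 1) ⟩
    + 4 * M m 1 0 + + 4 * (D 1 1 + - D 1 1)
      ≡⟨ solve 2 (λ v d → con (+ 4) :* v :+ con (+ 4) :* (d :+ :- d) := con (+ 4) :* v) refl (M m 1 0) (D 1 1) ⟩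
    + 4 * M m 1 0 ∎
    where
    W : ℤ
    W = M m 1 1
    D : ℕ → ℕ → ℤ
    D i j = + m * M (ℕ.pred m) i j

  -- Integration by parts for the odd exponent `m + 1`, whose moment at `(0, 0)` vanishes by
  -- antisymmetry.
  M-20 : ∀ m → -1ℤ ^ m ≡ 1ℤ →
    (1ℤ + L) * (M m 2 0 - M m 1 1) + (1ℤ + + m) * M m 2 0 ≡ + 4 * ((1ℤ + + m) * M m 1 0)
  M-20 m even = begin
    (1ℤ + L) * (M m 2 0 - M m 1 1) + (1ℤ + + m) * M m 2 0
      ≡⟨ M-by-parts (suc m) 0 0 ⟩
    + 2 * (M m 1 0 - M m 0 1) + E
      ≡⟨ cong (λ x → + 2 * (M m 1 0 - x) + E) (M-swap m even 0 1) ⟩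
    + 2 * (M m 1 0 - M m 1 0) + E
      ≡⟨ solve 2 (λ v e → con (+ 2) :* (v :- v) :+ e := e) refl (M m 1 0) E ⟩
    E ∎
    where
    E : ℤ
    E = + 4 * ((1ℤ + + m) * M m 1 0)

  private
    -- The three factors of `K` are the coefficients of `M m 2 0`, `M m 1 1` and `M m 1 0` in
    -- `M-20`, `M-11` and `M-10`, cleared as these moments are eliminated.
    K c : ℤ → ℤ
    K m = (+ 2 + L + m) * (+ 2 + (L + L) + m) * (1ℤ + L + m)
    c m = + 16 * ((1ℤ + m) * (1ℤ + m)) * (1ℤ + (L + L) + m)

  M-00-rec : ∀ m → -1ℤ ^ m ≡ 1ℤ → K (+ m) * M (suc (suc m)) 0 0 ≡ c (+ m) * M m 0 0
  M-00-rec m even = begin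
    K (+ m) * ((X - W) - (W - M m 0 2))
      ≡⟨ cong (λ x → K (+ m) * ((X - W) - (W - x))) (M-swap m even 0 2) ⟩
    K (+ m) * ((X - W) - (W - X))
      -- By symmetry the new moment is `2(X - W)`. The left side of `M-20` equals
      -- `(2 + L + m)(X - W) + (1 + m)W`, so subtracting a multiple of `M-11` removes the lone `W`.
      ≡⟨ solve 4 (λ l m x w →
           (con (+ 2) :+ l :+ m) :* (con (+ 2) :+ (l :+ l) :+ m) :* (con 1ℤ :+ l :+ m) :* ((x :- w) :- (w :- x))
           := con (+ 2) :* (con 1ℤ :+ l :+ m) :* (con (+ 2) :+ (l :+ l) :+ m)
                :* ((con 1ℤ :+ l) :* (x :- w) :+ (con 1ℤ :+ m) :* x)
              :- con (+ 2) :* (con 1ℤ :+ l :+ m) :* (con 1ℤ :+ m) :* ((con (+ 2) :+ (l :+ l) :+ m) :* w))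
           refl L (+ m) X W ⟩
    p * ((1ℤ + L) * (X - W) + (1ℤ + + m) * X) - q * ((+ 2 + (L + L) + + m) * W)
      ≡⟨ cong₂ (λ x y → p * x - q * y) (M-20 m even) (M-11 m even) ⟩
    p * (+ 4 * ((1ℤ + + m) * V)) - q * (+ 4 * V)
      ≡⟨ solve 3 (λ l m v →
           con (+ 2) :* (con 1ℤ :+ l :+ m) :* (con (+ 2) :+ (l :+ l) :+ m) :* (con (+ 4) :* ((con 1ℤ :+ m) :* v))
             :- con (+ 2) :* (con 1ℤ :+ l :+ m) :* (con 1ℤ :+ m) :* (con (+ 4) :* v)
           := con (+ 8) :* (con 1ℤ :+ m) :* (con 1ℤ :+ (l :+ l) :+ m) :* ((con 1ℤ :+ l :+ m) :* v))
           refl L (+ m) V ⟩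
    + 8 * (1ℤ + + m) * (1ℤ + (L + L) + + m) * ((1ℤ + L + + m) * V)
      ≡⟨ cong (+ 8 * (1ℤ + + m) * (1ℤ + (L + L) + + m) *_) (M-10 m even) ⟩
    + 8 * (1ℤ + + m) * (1ℤ + (L + L) + + m) * ((+ 2 + + 2 * + m) * U)
      ≡⟨ solve 3 (λ l m u →
           con (+ 8) :* (con 1ℤ :+ m) :* (con 1ℤ :+ (l :+ l) :+ m) :* ((con (+ 2) :+ con (+ 2) :* m) :* u)
           := con (+ 16) :* ((con 1ℤ :+ m) :* (con 1ℤ :+ m)) :* (con 1ℤ :+ (l :+ l) :+ m) :* u)
           refl L (+ m) U ⟩
    c (+ m) * U ∎
    where
    U V W X p q : ℤ
    U = M m 0 0
    V = M m 1 0
    W = M m 1 1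
    X = M m 2 0
    p = + 2 * (1ℤ + L + + m) * (+ 2 + (L + L) + + m)
    q = + 2 * (1ℤ + L + + m) * (1ℤ + + m)

  -- Recurrence for the right-hand side

  R : ℕ → ℤ
  R n = + superCatalan n l * + superCatalan (n ℕ.+ l) n

  R-rec : ∀ n → K (+ 2 * + n) * R (suc n) ≡ c (+ 2 * + n) * R n
  R-rec n = begin
    K (+ 2 * N) * (S′ * P″)
      -- `K` at `2n` is `2(1 + n + l)(1 + 2n + l)(2 + 2n + l)`: one factor for each unit step, from
      -- `S` to `S′`, from `P` to `P′` and from `P′` to `P″`.
      ≡⟨ solve 4 (λ l n s p →
           (con (+ 2) :+ l :+ con (+ 2) :* n) :* (con (+ 2) :+ (l :+ l) :+ con (+ 2) :* n)
             :* (con 1ℤ :+ l :+ con (+ 2) :* n) :* (s :* p)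
           := con (+ 2) :* ((con 1ℤ :+ (n :+ l)) :* s)
                :* ((con 1ℤ :+ ((n :+ l) :+ n)) :* ((con 1ℤ :+ (n :+ (con 1ℤ :+ (n :+ l)))) :* p)))
           refl L N S′ P″ ⟩
    + 2 * (+ suc (n ℕ.+ l) * S′) * (+ suc ((n ℕ.+ l) ℕ.+ n) * (+ suc (n ℕ.+ suc (n ℕ.+ l)) * P″))
      ≡⟨ cong₂ (λ x y → + 2 * x * (+ suc ((n ℕ.+ l) ℕ.+ n) * y)) (superCatalan-sucˡ n l) P″-rec ⟩
    + 2 * ((+ 2 + + 4 * N) * S) * (+ suc ((n ℕ.+ l) ℕ.+ n) * ((+ 2 + + 4 * N) * P′))
      ≡⟨ solve 4 (λ a b s p → con (+ 2) :* (a :* s) :* (b :* (a :* p))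
           := con (+ 2) :* (a :* s) :* (a :* (b :* p))) refl (+ 2 + + 4 * N) (+ suc ((n ℕ.+ l) ℕ.+ n)) S P′ ⟩
    + 2 * ((+ 2 + + 4 * N) * S) * ((+ 2 + + 4 * N) * (+ suc ((n ℕ.+ l) ℕ.+ n) * P′))
      ≡⟨ cong (λ x → + 2 * ((+ 2 + + 4 * N) * S) * ((+ 2 + + 4 * N) * x)) (superCatalan-sucˡ (n ℕ.+ l) n) ⟩
    + 2 * ((+ 2 + + 4 * N) * S) * ((+ 2 + + 4 * N) * ((+ 2 + + 4 * (N + L)) * P))
      ≡⟨ solve 4 (λ l n s p →
           con (+ 2) :* ((con (+ 2) :+ con (+ 4) :* n) :* s)
             :* ((con (+ 2) :+ con (+ 4) :* n) :* ((con (+ 2) :+ con (+ 4) :* (n :+ l)) :* p))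
           := con (+ 16) :* ((con 1ℤ :+ con (+ 2) :* n) :* (con 1ℤ :+ con (+ 2) :* n))
                :* (con 1ℤ :+ (l :+ l) :+ con (+ 2) :* n) :* (s :* p)) refl L N S P ⟩
    c (+ 2 * N) * (S * P) ∎
    where
    N S S′ P P′ P″ : ℤ
    N = + n
    S = + superCatalan n l
    S′ = + superCatalan (suc n) l
    P = + superCatalan (n ℕ.+ l) n
    P′ = + superCatalan (suc (n ℕ.+ l)) n
    P″ = + superCatalan (suc (n ℕ.+ l)) (suc n)

    -- The second argument is raised here, so symmetry moves it to the first place.
    P″-rec : + suc (n ℕ.+ suc (n ℕ.+ l)) * P″ ≡ (+ 2 + + 4 * N) * P′
    P″-rec
      rewrite superCatalan-comm (suc (n ℕ.+ l)) (suc n)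
            | superCatalan-comm (suc (n ℕ.+ l)) n
      = superCatalan-sucˡ n (suc (n ℕ.+ l))

  -- Comparison of the two sides

  M-closed : ∀ n → M (2 ℕ.* n) 0 0 ≡ R n
  M-closed zero    = cong (λ x → f 0 * + x) (superCatalan-comm 0 l)
  M-closed (suc n) = *-cancelˡ-≡ (K (+ m)) _ _ (begin
    K (+ m) * M (2 ℕ.* suc n) 0 0   ≡⟨ cong (λ x → K (+ m) * M x 0 0) (ℕ.*-suc 2 n) ⟩
    K (+ m) * M (suc (suc m)) 0 0   ≡⟨ M-00-rec m even ⟩
    c (+ m) * M m 0 0               ≡⟨ cong₂ _*_ (cong c (pos-* 2 n)) (M-closed n) ⟩
    c (+ 2 * + n) * R n             ≡⟨ R-rec n ⟨
    K (+ 2 * + n) * R (suc n)       ≡⟨ cong (λ x → K x * R (suc n)) (pos-* 2 n) ⟨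
    K (+ m) * R (suc n)             ∎)
    where
    m : ℕ
    m = 2 ℕ.* n
    even : -1ℤ ^ m ≡ 1ℤ
    even = trans (sym (^-*-assoc -1ℤ 2 n)) (^-zeroˡ n)
    -- Every factor of `K` is positive because `l` and `m` are non-negative, so `K` may be
    -- cancelled.
    instance
      _ = i*j≢0 (+ 2 + L + + m) (+ 2 + (L + L) + + m)
      _ = i*j≢0 ((+ 2 + L + + m) * (+ 2 + (L + L) + + m)) (1ℤ + L + + m)

theorem1 : ∀ (n l : ℕ) →
    ∑[ k ≤ 2 ℕ.* n ] (-1ℤ ^ toℕ k * (+ ((2 ℕ.* n) C toℕ k)) * (+ superCatalan (toℕ k) l) * (+ superCatalan (2 ℕ.* n ∸ toℕ k) l))
    ≡ (+ superCatalan n l) * (+ superCatalan (n ℕ.+ l) n)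
theorem1 n l = begin
  ∑[ k ≤ m ] (-1ℤ ^ toℕ k * + (m C toℕ k) * S (toℕ k) * S (m ∸ toℕ k))
    -- In the expansion of (x - y)ᵐ the index k is the exponent of y, so the two moments trade
    -- places.
    ≡⟨ sum-cong-≗ {n = suc m} reorder ⟩
  ∑[ k ≤ m ] (-1ℤ ^ toℕ k * + (m C toℕ k) * (S ((m ∸ toℕ k) ℕ.+ 0) * S (toℕ k ℕ.+ 0)))
    ≡⟨ Δ-binomial (λ i j → S i * S j) m 0 0 ⟨
  M l m 0 0
    ≡⟨ M-closed l n ⟩
  R l n ∎
  where
  m : ℕ
  m = 2 ℕ.* n
  S : ℕ → ℤ
  S i = + superCatalan i l
  reorder : ∀ (k : Fin (suc m)) →
    -1ℤ ^ toℕ k * + (m C toℕ k) * S (toℕ k) * S (m ∸ toℕ k)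
    ≡ -1ℤ ^ toℕ k * + (m C toℕ k) * (S ((m ∸ toℕ k) ℕ.+ 0) * S (toℕ k ℕ.+ 0))
  reorder k = trans (*-assoc s _ _) (cong (s *_) (trans (*-comm (S (toℕ k)) _)
    (cong₂ (λ i j → S i * S j) (sym (ℕ.+-identityʳ (m ∸ toℕ k))) (sym (ℕ.+-identityʳ (toℕ k))))))
    where
    s : ℤ
    s = -1ℤ ^ toℕ k * + (m C toℕ k)
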